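{- Let $\vec S$ be a submodular separation system (inside some universe), and let $\mathcal P$ be a set of profiles of $S$. Then there exists a nested set $N=N(\vec S,\mathcal P)\subseteq S$ that distinguishes all profiles in $\mathcal P$ (any two distinct elements of $\mathcal P$ orient some non-degenerate element of $N$ differently) and contains only separations which are good for $\mathcal P$. Moreover, this set $N$ can be chosen so that the following holds: if $\vec S'$ is a submodular separation system (inside some universe) and $\varphi:\vec S\to\vec S'$ is an isomorphism of separation systems such that for all $\vec r,\vec s\in\vec S$ we have $\vec r\vee\vec s\in\vec S$ if and only if $\varphi(\vec r)\vee\varphi(\vec s)\in\vec S'$ (suprema in the respective universes), then $\varphi(N(\vec S,\mathcal P))=N(\vec S',\varphi(\mathcal P))$, where $\varphi(\mathcal P)=\{\varphi(P):P\in\mathcal P\}$.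
   Context: A separation system $(\vec S,\le,{}^*)$ is a poset with an order-reversing involution ${}^*$. Elements are written $\vec s$ (oriented separations), with inverse $\overleftarrow s=(\vec s)^*$; $s=\{\vec s,\overleftarrow s\}$ is the unoriented separation with orientations $\vec s,\overleftarrow s$ (no orientation is the default one), and $S$ is the set of all such $s$. A universe $\vec U$ is a separation system that is a lattice, with supremum $\vee$ and infimum $\wedge$. $\vec S$ is submodular if it lies inside a universe $\vec U$ (i.e. $\vec S\subseteq\vec U$, with order and involution induced from $\vec U$) and for all $\vec r,\vec s\in\vec S$ at least one of $\vec r\vee\vec s$, $\vec r\wedge\vec s$ (taken in $\vec U$) lies in $\vec S$. Two separations are nested if they have comparable orientations; a set of separations is nested if its elements are pairwise nested. An isomorphism of separation systems is a bijection that is order-respecting and commutes with the involutions; it acts on unoriented separations by $\varphi(s)=\{\varphi(\vec s),\varphi(\overleftarrow s)\}$. $s$ is degenerate if $\vec s=\overleftarrow s$. An orientation of $S$ is a set $O\subseteq\vec S$ containing every degenerate separation and exactly one orientation of every non-degenerate $s\in S$. It is consistent if it does not contain both $\overleftarrow r$ and $\vec s$ whenever $\vec r<\vec s$ for distinct $r,s\in S$. A profile of $S$ is a consistent orientation $P$ of $S$ such that $(\vec r\vee\vec s)^*\notin P$ for all $\vec r,\vec s\in P$. For a profile $P$ of $S$, a separation $\vec s\in\vec S$ is closely related to $P$ if $\vec s\in P$ and $\vec s\wedge\vec r\in\vec S$ for every $\vec r\in P$. A separation $s\in S$ is good for $\mathcal P$ if there are profiles $P\neq P'$ in $\mathcal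 P$ such that $\vec s$ is closely related to $P$ and $\overleftarrow s$ is closely related to $P'$.
   Formalization: The separation systems are assumed finite (without this the claim fails, e.g. for the countable atomless Boolean algebra with all prime ideals as profiles), so the set of profiles is a finite list; equality in the universe is assumed decidable, which is automatic classically. -}

module Defs where

open import Level using (Level; _⊔_; suc)
open import Data.List.Base using (List)
open import Data.List.Membership.Propositional using () renaming (_∈_ to _∈ˡ_)
import Data.List.Relation.Unary.Enumerates.Setoid as Enumerates
open import Data.Product using (Σ; ∃; ∃-syntax; Σ-syntax; _×_; _,_; proj₁; proj₂)
open import Data.Sum.Base using (_⊎_)
open import Function.Bundles using (_⇔_)
open import Relation.Binary using (Poset; Decidable; _Respects_)
import Relation.Binary.Construct.NonStrictToStrict as Strict
import Relation.Binary.Construct.On as On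
open import Relation.Binary.Lattice using (Supremum; Infimum)
open import Relation.Binary.Morphism.Structures using (IsOrderIsomorphism)
open import Relation.Nullary using (¬_)
open import Relation.Unary using (Pred; _∈_; _∉_; _⊆_; _≐_)

private
  variable
    c ℓ₁ ℓ₂ p : Level

record SeparationSystem c ℓ₁ ℓ₂ : Set (suc (c ⊔ ℓ₁ ⊔ ℓ₂)) where
  infixl 8 _*
  field
    poset : Poset c ℓ₁ ℓ₂
  open Poset poset public hiding (_∼_)
  field
    _*           : Carrier → Carrier
    *-involutive : ∀ s → s * * ≈ s
    *-antitone   : ∀ {r s} → r ≤ s → s * ≤ r *

record Universe c ℓ₁ ℓ₂ : Set (suc (c ⊔ ℓ₁ ⊔ ℓ₂)) where
  infixr 6 _∨_
  infixr 7 _∧_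
  field
    separationSystem : SeparationSystem c ℓ₁ ℓ₂
  open SeparationSystem separationSystem public
  field
    _∨_      : Carrier → Carrier → Carrier
    _∧_      : Carrier → Carrier → Carrier
    supremum : Supremum _≤_ _∨_
    infimum  : Infimum _≤_ _∧_

  open Strict _≈_ _≤_ public using (_<_)

  Degenerate : Carrier → Set ℓ₁
  Degenerate s = s ≈ s *

  -- The unoriented separation {s , s *} is represented by either of its
  -- orientations; r ∼ s says that r and s represent the same one.
  infix 4 _∼_
  _∼_ : Carrier → Carrier → Set ℓ₁
  r ∼ s = r ≈ s ⊎ r ≈ s *

  Nested : Carrier → Carrier → Set (c ⊔ ℓ₁ ⊔ ℓ₂)
  Nested r s = ∃[ r′ ] ∃[ s′ ] (r′ ∼ r × s′ ∼ s × (r′ ≤ s′ ⊎ s′ ≤ r′))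

-- A separation system S lying inside the universe U, with induced order and
-- involution.
record Subsystem (U : Universe c ℓ₁ ℓ₂) p : Set (c ⊔ ℓ₁ ⊔ ℓ₂ ⊔ suc p) where
  open Universe U
  field
    S          : Pred Carrier p
    S-resp-≈   : S Respects _≈_
    S-closed-* : ∀ {s} → s ∈ S → s * ∈ S

  induced : SeparationSystem (c ⊔ p) ℓ₁ ℓ₂
  induced = record
    { poset        = On.poset {B = Σ Carrier S} poset proj₁
    ; _*           = λ (s , s∈S) → s * , S-closed-* s∈S
    ; *-involutive = λ (s , _) → *-involutive s
    ; *-antitone   = *-antitone
    }

  open Enumerates (Poset.Eq.setoid (SeparationSystem.poset induced)) using (IsEnumeration)

  Finite : Set (c ⊔ ℓ₁ ⊔ p)
  Finite = ∃ IsEnumeration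

  Submodular : Set (c ⊔ p)
  Submodular = ∀ {r s} → r ∈ S → s ∈ S → r ∨ s ∈ S ⊎ r ∧ s ∈ S

-- Finiteness is a standing assumption; only S has to be finite, U need not be.
-- Decidable equality makes membership in S, and with it all the combinatorics
-- of the finite set S, decidable. It holds automatically in classical logic.
record SubmodularSystem c ℓ₁ ℓ₂ p : Set (suc (c ⊔ ℓ₁ ⊔ ℓ₂ ⊔ p)) where
  field
    universe  : Universe c ℓ₁ ℓ₂
    subsystem : Subsystem universe p
  open Universe universe public
  open Subsystem subsystem public
  field
    _≟_        : Decidable _≈_
    finite     : Finite
    submodular : Submodular

module _ (𝐒 : SubmodularSystem c ℓ₁ ℓ₂ p) where
  open SubmodularSystem 𝐒

  record IsOrientation (O : Pred Carrier p) : Set (c ⊔ ℓ₁ ⊔ p) where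
    field
      O⊆S        : O ⊆ S
      O-resp-≈   : O Respects _≈_
      degenerate : ∀ {s} → s ∈ S → Degenerate s → s ∈ O
      exactlyOne : ∀ {s} → s ∈ S → ¬ Degenerate s →
                   (s ∈ O × s * ∉ O) ⊎ (s * ∈ O × s ∉ O)

  Consistent : Pred Carrier p → Set (c ⊔ ℓ₁ ⊔ ℓ₂ ⊔ p)
  Consistent O = ∀ {r s} → r ∈ S → s ∈ S → ¬ (r ∼ s) → r < s →
                 ¬ (r * ∈ O × s ∈ O)

  record Profile : Set (c ⊔ ℓ₁ ⊔ ℓ₂ ⊔ suc p) where
    field
      set           : Pred Carrier p
      isOrientation : IsOrientation set
      consistent    : Consistent set
      profile       : ∀ {r s} → r ∈ set → s ∈ set → (r ∨ s) * ∉ set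

  -- A set of unoriented separations in S, given by all orientations of its elements.
  record SeparationSet : Set (c ⊔ ℓ₁ ⊔ suc p) where
    field
      set     : Pred Carrier p
      set⊆S   : set ⊆ S
      resp-∼  : ∀ {r s} → r ∼ s → r ∈ set → s ∈ set

open Profile public using () renaming (set to ⟦_⟧)
open SeparationSet public using () renaming (set to orientations)

-- A set of profiles of the finite system S is finite, and is given here by a
-- list; profiles are compared as sets, by _≐_, and the order and multiplicity of
-- list entries are disregarded (see IsImageOf).
module _ {𝐒 : SubmodularSystem c ℓ₁ ℓ₂ p} where
  open SubmodularSystem 𝐒

  infix 4 _≠_
  _≠_ : Profile 𝐒 → Profile 𝐒 → Set (c ⊔ p)
  P ≠ P′ = ¬ (⟦ P ⟧ ≐ ⟦ P′ ⟧)

  CloselyRelated : Carrier → Profile 𝐒 → Set (c ⊔ p)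
  CloselyRelated s P = s ∈ ⟦ P ⟧ × (∀ {r} → r ∈ ⟦ P ⟧ → s ∧ r ∈ S)

  Good : List (Profile 𝐒) → Carrier → Set (c ⊔ ℓ₁ ⊔ ℓ₂ ⊔ suc p)
  Good 𝒫 s = ∃[ P ] ∃[ P′ ] (P ∈ˡ 𝒫 × P′ ∈ˡ 𝒫 × P ≠ P′ ×
                             CloselyRelated s P × CloselyRelated (s *) P′)

  OrientedDifferently : Carrier → Profile 𝐒 → Profile 𝐒 → Set p
  OrientedDifferently s P P′ =
    (s ∈ ⟦ P ⟧ × s * ∈ ⟦ P′ ⟧) ⊎ (s * ∈ ⟦ P ⟧ × s ∈ ⟦ P′ ⟧)

  IsNested : SeparationSet 𝐒 → Set (c ⊔ ℓ₁ ⊔ ℓ₂ ⊔ p)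
  IsNested N = ∀ {r s} → r ∈ orientations N → s ∈ orientations N → Nested r s

  DistinguishesAll : SeparationSet 𝐒 → List (Profile 𝐒) → Set (c ⊔ ℓ₁ ⊔ ℓ₂ ⊔ suc p)
  DistinguishesAll N 𝒫 = ∀ {P P′} → P ∈ˡ 𝒫 → P′ ∈ˡ 𝒫 → P ≠ P′ →
    ∃[ s ] (s ∈ orientations N × ¬ Degenerate s × OrientedDifferently s P P′)

  ContainsOnlyGood : SeparationSet 𝐒 → List (Profile 𝐒) → Set (c ⊔ ℓ₁ ⊔ ℓ₂ ⊔ suc p)
  ContainsOnlyGood N 𝒫 = ∀ {s} → s ∈ orientations N → Good 𝒫 s

record Isomorphism (A B : SeparationSystem c ℓ₁ ℓ₂) : Set (c ⊔ ℓ₁ ⊔ ℓ₂) where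
  private
    module A = SeparationSystem A
    module B = SeparationSystem B
  field
    φ                  : A.Carrier → B.Carrier
    isOrderIsomorphism : IsOrderIsomorphism A._≈_ B._≈_ A._≤_ B._≤_ φ
    φ-*                : ∀ s → φ (s A.*) B.≈ φ s B.*

module _ (𝐒 𝐒′ : SubmodularSystem c ℓ₁ ℓ₂ p) where
  private
    module 𝐒  = SubmodularSystem 𝐒
    module 𝐒′ = SubmodularSystem 𝐒′

  module _ (iso : Isomorphism 𝐒.induced 𝐒′.induced) where
    open Isomorphism iso

    RespectsJoins : Set (c ⊔ p)
    RespectsJoins = ∀ (r s : Σ 𝐒.Carrier 𝐒.S) →
      (proj₁ r 𝐒.∨ proj₁ s ∈ 𝐒.S) ⇔ (proj₁ (φ r) 𝐒′.∨ proj₁ (φ s) ∈ 𝐒′.S)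

    -- For the set of all orientations of the elements of N, this is the set of
    -- all orientations of the elements of φ(N), as φ commutes with the involutions.
    Image : Pred 𝐒.Carrier p → Pred 𝐒′.Carrier (c ⊔ ℓ₁ ⊔ p)
    Image X t = Σ[ s ∈ Σ 𝐒.Carrier 𝐒.S ] (proj₁ s ∈ X × proj₁ (φ s) 𝐒′.≈ t)

    -- 𝒫′ = { φ(P) : P ∈ 𝒫 }, as sets of profiles.
    IsImageOf : List (Profile 𝐒′) → List (Profile 𝐒) → Set (c ⊔ ℓ₁ ⊔ ℓ₂ ⊔ suc p)
    IsImageOf 𝒫′ 𝒫 =
        (∀ {P}  → P  ∈ˡ 𝒫  → ∃[ P′ ] (P′ ∈ˡ 𝒫′ × Image ⟦ P ⟧ ≐ ⟦ P′ ⟧))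
      × (∀ {P′} → P′ ∈ˡ 𝒫′ → ∃[ P ]  (P  ∈ˡ 𝒫  × Image ⟦ P ⟧ ≐ ⟦ P′ ⟧))

{-# OPTIONS --safe #-}
-- For a profile P let C(P) be the set of separations closely related to P.  If s ∈ C(P),
-- r ∈ C(R) and s ∈ R, then s ∧ r ∈ C(P).  In particular C(P) is closed under ∧, so for P ≠ Q
-- there is a least m(P,Q) in C(P) ∖ Q; its inverse turns out to be closely related to Q, so it
-- is good.  Combining leastness with the meet rule, s = m(P,Q) satisfies s ≤ r whenever
-- r ∈ C(R), s ∈ R and r ∉ Q.  All nestedness comes from this one observation.
--
-- A ≤-minimal element m(P′,P) of all the m's lies in every profile other than P, so it isolates
-- P.  The separations m(P′,P) isolating a profile P are nested with each other and with every
-- good separation for the non-isolated profiles.  Taking them all, discarding the isolated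
-- profiles and iterating yields N; no choices are made, so N is canonical.
module Submission where

open import Defs
open import Data.List.Base using (List; []; _∷_; map; filter; length)
open import Data.List.Membership.Propositional using (find; lose) renaming (_∈_ to _∈ˡ_)
open import Data.List.Membership.Propositional.Properties using (∈-filter⁺; ∈-filter⁻)
open import Data.List.Properties using (filter-all; filter-notAll)
open import Data.List.Relation.Unary.All as All using (All; []; _∷_)
open import Data.List.Relation.Unary.All.Properties using (¬Any⇒All¬)
open import Data.List.Relation.Unary.Any as Any using (Any; here; there)
open import Data.List.Relation.Unary.Any.Properties using (map⁺)
open import Data.Nat.Base using () renaming (_<_ to _<ℕ_)
open import Data.Nat.Induction using (Acc; acc; <-wellFounded)
open import Data.Product using (∃; ∃-syntax; Σ; Σ-syntax; _×_; _,_; proj₁; proj₂; swap)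
open import Data.Sum using (_⊎_; inj₁; inj₂; [_,_]′)
import Data.Sum as Sum
open import Function using (_∘_; flip; id)
open import Function.Bundles using (_⇔_; mk⇔; module Equivalence)
open import Level using (Level; _⊔_; suc; Lift; lift; lower)
open import Relation.Binary using (Rel; IsPreorder; Decidable; _Respects_)
import Relation.Binary.Construct.Flip.EqAndOrd as Flip
open import Relation.Binary.Lattice using (Lattice)
open import Relation.Binary.Lattice.Properties.JoinSemilattice using (∨-cong)
open import Relation.Binary.Lattice.Properties.MeetSemilattice
  using (∧-cong; ∧-assoc; ∧-comm)
  renaming (≈-dec⇒≤-dec to ∧-≈-dec⇒≤-dec)
open import Relation.Binary.Morphism.Structures using (IsOrderIsomorphism)
open import Relation.Binary.PropositionalEquality as ≡ using (_≡_)
open import Relation.Nullary using (¬_; Dec; yes; no; contradiction; decidable-stable; ¬?)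
open import Relation.Nullary.Decidable
  using (True; toWitness; fromWitness; map′; _×-dec_; _⊎-dec_; _→-dec_)
import Relation.Unary as Unary
open import Relation.Unary using (Pred; _∈_; _∉_; _≐_)
open import Relation.Unary.Properties using (≐-trans)

private
  variable
    c ℓ₁ ℓ₂ p ℓ : Level

-- Lattice identities in the presence of the involution.

module UniverseProperties (𝐔 : Universe c ℓ₁ ℓ₂) where
  open Universe 𝐔

  lattice : Lattice c ℓ₁ ℓ₂
  lattice = record { isLattice = record
    { isPartialOrder = isPartialOrder ; supremum = supremum ; infimum = infimum } }

  open Lattice lattice public
    using (x≤x∨y; y≤x∨y; ∨-least; x∧y≤x; x∧y≤y; ∧-greatest; joinSemilattice; meetSemilattice)

  private
    variable
      r s : Carrier

  **≤ : ∀ s → s * * ≤ s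
  **≤ s = reflexive (*-involutive s)

  ≤** : ∀ s → s ≤ s * *
  ≤** s = reflexive (Eq.sym (*-involutive s))

  *-cong : r ≈ s → r * ≈ s *
  *-cong r≈s = antisym (*-antitone (reflexive (Eq.sym r≈s))) (*-antitone (reflexive r≈s))

  ≤*-swap : r ≤ s * → s ≤ r *
  ≤*-swap {s = s} r≤s* = trans (≤** s) (*-antitone r≤s*)

  *≤-swap : r * ≤ s → s * ≤ r
  *≤-swap {r} r*≤s = trans (*-antitone r*≤s) (**≤ r)

  ≈*-swap : r ≈ s * → s ≈ r *
  ≈*-swap {s = s} r≈s* = Eq.trans (Eq.sym (*-involutive s)) (*-cong (Eq.sym r≈s*))

  *-injective : r * ≈ s * → r ≈ s
  *-injective {r} {s} eq = Eq.trans (≈*-swap (Eq.sym eq)) (*-involutive s)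

  deMorgan : ∀ r s → (r * ∨ s *) * ≈ r ∧ s
  deMorgan r s = antisym
    (∧-greatest (*≤-swap (x≤x∨y _ _)) (*≤-swap (y≤x∨y _ _)))
    (≤*-swap (∨-least (*-antitone (x∧y≤x r s)) (*-antitone (x∧y≤y r s))))

  deMorgan′ : ∀ r s → (r ∨ s *) * ≈ r * ∧ s
  deMorgan′ r s = Eq.trans
    (*-cong (∨-cong joinSemilattice (Eq.sym (*-involutive r)) Eq.refl)) (deMorgan (r *) s)

  x∧[y∧z]≈[y∧x]∧z : ∀ x y z → x ∧ (y ∧ z) ≈ (y ∧ x) ∧ z
  x∧[y∧z]≈[y∧x]∧z x y z = Eq.trans (Eq.sym (∧-assoc meetSemilattice x y z))
    (∧-cong meetSemilattice (∧-comm meetSemilattice x y) Eq.refl)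

  ∼-sym : r ∼ s → s ∼ r
  ∼-sym = Sum.map Eq.sym ≈*-swap

  Nested-sym : Nested r s → Nested s r
  Nested-sym (r′ , s′ , r′∼r , s′∼s , cmp) = s′ , r′ , s′∼s , r′∼r , Sum.swap cmp

module NestedSet (𝐒 : SubmodularSystem c ℓ₁ ℓ₂ p) where
  open SubmodularSystem 𝐒
  open UniverseProperties universe public

  private
    variable
      r s t x y : Carrier
      P P′ Q R : Profile 𝐒
      𝒫 : List (Profile 𝐒)

  _≤?_ : Decidable _≤_
  _≤?_ = ∧-≈-dec⇒≤-dec meetSemilattice _≟_

  *∨*∈S⇒∧∈S : r * ∨ s * ∈ S → r ∧ s ∈ S
  *∨*∈S⇒∧∈S = S-resp-≈ (deMorgan _ _) ∘ S-closed-*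

  ∧∈S⇒*∨*∈S : r ∧ s ∈ S → r * ∨ s * ∈ S
  ∧∈S⇒*∨*∈S r∧s∈S =
    S-resp-≈ (Eq.sym (≈*-swap (Eq.sym (deMorgan _ _)))) (S-closed-* r∧s∈S)

  -- Finite search in `S` and minimal elements.

  elements : List Carrier
  elements = map proj₁ (proj₁ finite)

  ∈S⇒∈elements : s ∈ S → Any (s ≈_) elements
  ∈S⇒∈elements {s} s∈S = map⁺ (proj₂ finite (s , s∈S))

  _∈S? : Unary.Decidable S
  s ∈S? = map′ (from (proj₁ finite)) ∈S⇒∈elements (Any.any? (s ≟_) elements)
    where
    from : ∀ (xs : List (Σ Carrier S)) → Any (s ≈_) (map proj₁ xs) → s ∈ S
    from ((_ , y∈S) ∷ _)  (here s≈y) = S-resp-≈ (Eq.sym s≈y) y∈S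
    from (_         ∷ xs) (there p)  = from xs p

  module _ {A : Pred Carrier ℓ} (A? : Unary.Decidable A) (resp : A Respects _≈_) where

    ∀S? : Dec (∀ {s} → s ∈ S → A s)
    ∀S? = map′ to (λ all → All.tabulate λ {s} _ → all {s})
      (All.all? (λ s → (s ∈S?) →-dec A? s) elements)
      where
      to : All (λ s → s ∈ S → A s) elements → ∀ {s} → s ∈ S → A s
      to all s∈S with y , y∈xs , s≈y ← find (∈S⇒∈elements s∈S) =
        resp (Eq.sym s≈y) (All.lookup all y∈xs (S-resp-≈ s≈y s∈S))

    module _ (A⊆S : A Unary.⊆ S) where

      ∃S? : Dec (∃ A)
      ∃S? = map′ (λ any → let y , _ , Ay = find any in y , Ay)
        (λ (s , As) → Any.map (λ s≈y → resp s≈y As) (∈S⇒∈elements (A⊆S As)))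
        (Any.any? A? elements)

      module _ {_≲_ : Rel Carrier ℓ₂} (isPreorder : IsPreorder _≈_ _≲_) (_≲?_ : Decidable _≲_) where
        private module ≲ = IsPreorder isPreorder

        -- The preorder is arbitrary so that flipping the order gives maximal elements. The scan
        -- starts from `x` and replaces the current candidate by each list entry that satisfies `A`
        -- and lies below it.
        minimal : A x → ∃[ m ] (A m × (∀ {y} → A y → y ≲ m → m ≲ y))
        minimal {x} Ax = let m , Am , min = go elements in m , Am , λ Ay y≲m →
          let z , z∈xs , y≈z = find (∈S⇒∈elements (A⊆S Ay))
          in ≲.trans
               (All.lookup min z∈xs (resp y≈z Ay) (≲.trans (≲.reflexive (Eq.sym y≈z)) y≲m))
               (≲.reflexive (Eq.sym y≈z))
          where
          go : ∀ xs → ∃[ m ] (A m × All (λ y → A y → y ≲ m → m ≲ y) xs)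
          go [] = x , Ax , []
          go (y ∷ xs) with go xs
          ... | m , Am , min with A? y ×-dec (y ≲? m)
          ...   | yes (Ay , y≲m) =
                  y , Ay , (λ _ y≲y → y≲y) ∷
                    All.map (λ h Az z≲y → ≲.trans y≲m (h Az (≲.trans z≲y y≲m))) min
          ...   | no ¬both = m , Am , (λ Ay y≲m → contradiction (Ay , y≲m) ¬both) ∷ min

  -- Elementary properties of profiles.

  module _ (P : Profile 𝐒) where
    open Profile P
    open IsOrientation isOrientation

    ∈⇒∈S : s ∈ set → s ∈ S
    ∈⇒∈S = O⊆S

    ∈-resp-≈ : set Respects _≈_
    ∈-resp-≈ = O-resp-≈

    ∉⇒*∈ : s ∈ S → s ∉ set → s * ∈ set
    ∉⇒*∈ {s} s∈S s∉P with s ≟ (s *)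
    ... | yes deg = contradiction (degenerate s∈S deg) s∉P
    ... | no ¬deg = [ (λ (s∈P , _) → contradiction s∈P s∉P) , proj₁ ]′ (exactlyOne s∈S ¬deg)

    bothIn⇒degenerate : s ∈ set → s * ∈ set → Degenerate s
    bothIn⇒degenerate {s} s∈P s*∈P with s ≟ (s *)
    ... | yes deg = deg
    ... | no ¬deg = [ contradiction s*∈P ∘ proj₂ , contradiction s∈P ∘ proj₂ ]′
        (exactlyOne (O⊆S s∈P) ¬deg)

    -- Membership is read off the axioms: degenerate elements of `S` always belong, and for the
    -- others `exactlyOne` says which case holds.
    _∈P? : Unary.Decidable set
    s ∈P? with s ∈S?
    ... | no s∉S = no (s∉S ∘ O⊆S)
    ... | yes s∈S with s ≟ (s *)
    ...   | yes deg = yes (degenerate s∈S deg)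
    ...   | no ¬deg = [ yes ∘ proj₁ , no ∘ proj₂ ]′ (exactlyOne s∈S ¬deg)

    -- A profile need not be regular: it may contain a co-small s, whose inverse s * ≤ s it omits.
    downClosed : r ∈ S → r ≤ s → s ∈ set → r ∈ set ⊎ r ≈ s *
    downClosed {r} {s} r∈S r≤s s∈P with r ∈P? | r ≟ s | r ≟ (s *)
    ... | yes r∈P | _       | _        = inj₁ r∈P
    ... | no _    | yes r≈s | _        = inj₁ (O-resp-≈ (Eq.sym r≈s) s∈P)
    ... | no _    | no _    | yes r≈s* = inj₂ r≈s*
    ... | no r∉P  | no r≉s  | no r≉s*  = contradiction (∉⇒*∈ r∈S r∉P , s∈P)
      (consistent r∈S (O⊆S s∈P) [ r≉s , r≉s* ]′ (r≤s , r≉s))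

    ∨-closed : r ∈ set → s ∈ set → r ∨ s ∈ S → r ∨ s ∈ set
    ∨-closed {r} {s} r∈P s∈P r∨s∈S =
      decidable-stable ((r ∨ s) ∈P?) (profile r∈P s∈P ∘ ∉⇒*∈ r∨s∈S)

    ∧-closed : r ∈ set → s ∈ set → r ∧ s ∈ S → r ∧ s ∈ set
    ∧-closed {r} {s} r∈P s∈P r∧s∈S
      with downClosed r∧s∈S (x∧y≤x r s) r∈P | downClosed r∧s∈S (x∧y≤y r s) s∈P
    ... | inj₁ r∧s∈P | _          = r∧s∈P
    ... | inj₂ _     | inj₁ r∧s∈P = r∧s∈P
    -- Both exceptional cases at once make the meet equal to `r *` and to `s *`, so `r ≈ s` and the
    -- meet is `r` itself.
    ... | inj₂ eq₁   | inj₂ eq₂   = O-resp-≈ r≈r∧s r∈P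
      where
      r≈s : r ≈ s
      r≈s = *-injective (Eq.trans (Eq.sym eq₁) eq₂)
      r≈r∧s : r ≈ r ∧ s
      r≈r∧s = antisym (∧-greatest refl (reflexive r≈s)) (x∧y≤x r s)

    *∈⇒∧∉ : r * ∈ set → s * ∈ set → r ∧ s ∉ set
    *∈⇒∧∉ r*∈P s*∈P r∧s∈P = profile r*∈P s*∈P (O-resp-≈ (Eq.sym (deMorgan _ _)) r∧s∈P)

    ∉⇒∧∉ : r ∈ S → s ∈ S → r ∉ set → s ∉ set → r ∧ s ∉ set
    ∉⇒∧∉ r∈S s∈S r∉P s∉P = *∈⇒∧∉ (∉⇒*∈ r∈S r∉P) (∉⇒*∈ s∈S s∉P)

  -- A degenerate separation lies in every profile, so one that `Q` omits is non-degenerate and `P`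
  -- cannot contain both of its orientations.
  *∉ : ∀ (P Q : Profile 𝐒) → s ∈ ⟦ P ⟧ → s ∉ ⟦ Q ⟧ → s * ∉ ⟦ P ⟧
  *∉ P Q s∈P s∉Q s*∈P = s∉Q (IsOrientation.degenerate (Profile.isOrientation Q)
    (∈⇒∈S P s∈P) (bothIn⇒degenerate P s∈P s*∈P))

  -- In the exceptional case `x ≈ s *` both orientations of `s` lie in `P`, so `s` is degenerate and
  -- `x` equals it.
  transfer : ∀ (P R : Profile 𝐒) → s ∈ ⟦ P ⟧ → s ∈ ⟦ R ⟧ → x ∈ ⟦ P ⟧ → x ≤ s → x ∈ ⟦ R ⟧
  transfer P R s∈P s∈R x∈P x≤s with downClosed R (∈⇒∈S P x∈P) x≤s s∈R
  ... | inj₁ x∈R  = x∈R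
  ... | inj₂ x≈s* = ∈-resp-≈ R
    (Eq.trans (bothIn⇒degenerate P s∈P (∈-resp-≈ P x≈s* x∈P)) (Eq.sym x≈s*)) s∈R

  -- One inclusion forces equality: if `P` is contained in `Q`, an element of `Q` outside `P` has
  -- its inverse in `P`, hence in `Q`, against `*∉`.
  separate : ∀ (P Q : Profile 𝐒) → (∃[ s ] (s ∈ ⟦ P ⟧ × s ∉ ⟦ Q ⟧)) ⊎ ⟦ P ⟧ ≐ ⟦ Q ⟧
  separate P Q
    with ∃S? (λ s → (_∈P? P s) ×-dec ¬? (_∈P? Q s))
             (λ r≈s (r∈P , r∉Q) → ∈-resp-≈ P r≈s r∈P , r∉Q ∘ ∈-resp-≈ Q (Eq.sym r≈s))
             (∈⇒∈S P ∘ proj₁)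
  ... | yes (s , s∈P∖Q) = inj₁ (s , s∈P∖Q)
  ... | no none = inj₂ (P⊆Q , Q⊆P)
    where
    P⊆Q : ∀ {s} → s ∈ ⟦ P ⟧ → s ∈ ⟦ Q ⟧
    P⊆Q {s} s∈P = decidable-stable (_∈P? Q s) λ s∉Q → none (s , s∈P , s∉Q)
    Q⊆P : ∀ {s} → s ∈ ⟦ Q ⟧ → s ∈ ⟦ P ⟧
    Q⊆P {s} s∈Q = decidable-stable (_∈P? P s) λ s∉P →
      *∉ Q P s∈Q s∉P (P⊆Q (∉⇒*∈ P (∈⇒∈S Q s∈Q) s∉P))

  _≐?_ : ∀ (P Q : Profile 𝐒) → Dec (⟦ P ⟧ ≐ ⟦ Q ⟧)
  P ≐? Q with separate P Q
  ... | inj₁ (_ , s∈P , s∉Q) = no λ (P⊆Q , _) → s∉Q (P⊆Q s∈P)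
  ... | inj₂ P≐Q = yes P≐Q

  -- Closely related separations.

  CloselyRelated-resp-≈ : ∀ (P : Profile 𝐒) → r ≈ s → CloselyRelated r P → CloselyRelated s P
  CloselyRelated-resp-≈ P r≈s (r∈P , close) = ∈-resp-≈ P r≈s r∈P , λ q∈P →
    S-resp-≈ (∧-cong meetSemilattice r≈s Eq.refl) (close q∈P)

  CloselyRelated? : ∀ (P : Profile 𝐒) → Unary.Decidable (λ s → CloselyRelated s P)
  CloselyRelated? P s = (_∈P? P s) ×-dec
    map′ (λ (all : ∀ {r} → r ∈ S → r ∈ ⟦ P ⟧ → s ∧ r ∈ S) r∈P → all (∈⇒∈S P r∈P) r∈P)
         (λ close _ → close)
      (∀S? {A = λ r → r ∈ ⟦ P ⟧ → s ∧ r ∈ S}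
        (λ r → (_∈P? P r) →-dec ((s ∧ r) ∈S?))
        (λ q≈r f r∈P → S-resp-≈ (∧-cong meetSemilattice Eq.refl q≈r)
          (f (∈-resp-≈ P (Eq.sym q≈r) r∈P))))

  -- For `q` in `P`, regroup `(s ∧ r) ∧ q` as `r ∧ (s ∧ q)`. The element `s ∧ q` of `P` lies below
  -- `s`, so it also belongs to `R`, where the close relation of `r` applies.
  ∧-closelyRelated : ∀ (P R : Profile 𝐒) → CloselyRelated s P → CloselyRelated r R → s ∈ ⟦ R ⟧ →
                     CloselyRelated (s ∧ r) P
  ∧-closelyRelated {s} {r} P R (s∈P , closeₛ) (r∈R , closeᵣ) s∈R =
    transfer R P s∈R s∈P s∧r∈R (x∧y≤x s r) , λ {q} q∈P →
      S-resp-≈ (x∧[y∧z]≈[y∧x]∧z r s q)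
        (closeᵣ (transfer P R s∈P s∈R (∧-closed P s∈P q∈P (closeₛ q∈P)) (x∧y≤x s q)))
    where
    s∧r∈R : s ∧ r ∈ ⟦ R ⟧
    s∧r∈R = ∧-closed R s∈R r∈R (S-resp-≈ (∧-comm meetSemilattice r s) (closeᵣ s∈R))

  -- For `r` in `P`, if `s ∨ r` is in `S` then it lies in `P` and not in `Q`, so maximality gives
  -- `r ≤ s` and the meet is `r`. Otherwise submodularity supplies the meet.
  maximal⇒closelyRelated : ∀ (P Q : Profile 𝐒) → s ∈ ⟦ P ⟧ → s ∉ ⟦ Q ⟧ →
    (∀ {x} → x ∈ ⟦ P ⟧ × x ∉ ⟦ Q ⟧ → s ≤ x → x ≤ s) → CloselyRelated s P
  maximal⇒closelyRelated {s} P Q s∈P s∉Q max = s∈P , λ {r} r∈P →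
    [ (λ s∨r∈S →
        let s∨r∈P = ∨-closed P s∈P r∈P s∨r∈S
            r≤s = trans (y≤x∨y s r) (max (s∨r∈P , s∨r∉Q r∈P) (x≤x∨y s r))
        in S-resp-≈ (antisym (∧-greatest r≤s refl) (x∧y≤y s r)) (∈⇒∈S P r∈P))
    , id ]′ (submodular s∈S (∈⇒∈S P r∈P))
    where
    s∈S : s ∈ S
    s∈S = ∈⇒∈S P s∈P
    s∨r∉Q : ∀ {r} → r ∈ ⟦ P ⟧ → s ∨ r ∉ ⟦ Q ⟧
    s∨r∉Q r∈P s∨r∈Q with downClosed Q s∈S (x≤x∨y s _) s∨r∈Q
    ... | inj₁ s∈Q = s∉Q s∈Q
    ... | inj₂ s≈[s∨r]* = Profile.profile P s∈P r∈P (∈-resp-≈ P s≈[s∨r]* s∈P)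

  -- The least separations m(P,Q) and their inverses.

  record Least (P Q : Profile 𝐒) (s : Carrier) : Set (c ⊔ ℓ₁ ⊔ ℓ₂ ⊔ p) where
    field
      close : CloselyRelated s P
      avoid : s ∉ ⟦ Q ⟧
      least : ∀ {x} → CloselyRelated x P → x ∉ ⟦ Q ⟧ → s ≤ x

    contained : s ∈ ⟦ P ⟧
    contained = proj₁ close

    s∈S : s ∈ S
    s∈S = ∈⇒∈S P contained

    *∈Q : s * ∈ ⟦ Q ⟧
    *∈Q = ∉⇒*∈ Q s∈S avoid

    -- The meet rule puts `s ∧ r` among the candidates over which `s` is least: it is closely
    -- related to `P`, and `Q` omits it because it omits both `s` and `r`.
    least-via : ∀ R → CloselyRelated r R → s ∈ ⟦ R ⟧ → r ∉ ⟦ Q ⟧ → s ≤ r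
    least-via {r} R r∈C s∈R r∉Q = trans
      (least (∧-closelyRelated P R close r∈C s∈R) (∉⇒∧∉ Q s∈S (∈⇒∈S R (proj₁ r∈C)) avoid r∉Q))
      (x∧y≤y s r)

    private
      -- By De Morgan, these are the `r` whose inverse witnesses that `s *` fails to be closely
      -- related to `Q`.
      Bad : Pred Carrier p
      Bad r = r * ∈ ⟦ Q ⟧ × s ∨ r ∉ S

      Bad⇒∈S : ∀ {r} → Bad r → r ∈ S
      Bad⇒∈S {r} (r*∈Q , _) = S-resp-≈ (*-involutive r) (S-closed-* (∈⇒∈S Q r*∈Q))

      Bad⇒≰ : ∀ {r} → Bad r → ¬ r ≤ s
      Bad⇒≰ (_ , s∨r∉S) r≤s = s∨r∉S (S-resp-≈ (antisym (x≤x∨y _ _) (∨-least refl r≤s)) s∈S)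

      Bad⇒∧∈S : ∀ {r} → Bad r → s ∧ r ∈ S
      Bad⇒∧∈S bad@(_ , s∨r∉S) =
        [ (λ s∨r∈S → contradiction s∨r∈S s∨r∉S) , id ]′ (submodular s∈S (Bad⇒∈S bad))

      Bad⇒∧∉Q : ∀ {r} → Bad r → s ∧ r ∉ ⟦ Q ⟧
      Bad⇒∧∉Q (r*∈Q , _) = *∈⇒∧∉ Q *∈Q r*∈Q

      -- Joining with an element below `s` does not change the join with `s`; the work lies in
      -- keeping the inverse in `Q`. This lets maximality among bad elements be applied to `r ∨ q`.
      Bad-∨ : ∀ {r q} → Bad r → q ≤ s → r ∨ q ∈ S → Bad (r ∨ q)
      Bad-∨ {r} {q} bad@(r*∈Q , s∨r∉S) q≤s r∨q∈S = [r∨q]*∈Q , s∨[r∨q]∉S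
        where
        s∨[r∨q]≈s∨r : s ∨ (r ∨ q) ≈ s ∨ r
        s∨[r∨q]≈s∨r = antisym
          (∨-least (x≤x∨y s r) (∨-least (y≤x∨y s r) (trans q≤s (x≤x∨y s r))))
          (∨-least (x≤x∨y s _) (trans (x≤x∨y r q) (y≤x∨y s _)))
        s∨[r∨q]∉S : s ∨ (r ∨ q) ∉ S
        s∨[r∨q]∉S = s∨r∉S ∘ S-resp-≈ s∨[r∨q]≈s∨r
        r∈S : r ∈ S
        r∈S = Bad⇒∈S bad
        -- If (r ∨ q) * is not in Q then it is r, so r is small, and comparing s ∧ r with
        -- s ∧ r * shows that r ≤ s.
        [r∨q]*∈Q : (r ∨ q) * ∈ ⟦ Q ⟧
        [r∨q]*∈Q with downClosed Q (S-closed-* r∨q∈S) (*-antitone (x≤x∨y r q)) r*∈Q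
        ... | inj₁ ∈Q = ∈Q
        ... | inj₂ [r∨q]*≈r** = contradiction r≤s (Bad⇒≰ bad)
          where
          r∨q≈r* : r ∨ q ≈ r *
          r∨q≈r* = *-injective [r∨q]*≈r**
          z : Carrier
          z = s ∧ r *
          z∈S : z ∈ S
          z∈S = [ (λ s∨r*∈S → contradiction
                    (S-resp-≈ (∨-cong joinSemilattice Eq.refl (Eq.sym r∨q≈r*)) s∨r*∈S) s∨[r∨q]∉S)
                , id ]′ (submodular s∈S (S-closed-* r∈S))
          s∧r≤z : s ∧ r ≤ z
          s∧r≤z = ∧-greatest (x∧y≤x s r)
            (trans (x∧y≤y s r) (trans (x≤x∨y r q) (reflexive r∨q≈r*)))
          r≤s : r ≤ s
          r≤s with downClosed Q z∈S (x∧y≤y s _) r*∈Q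
          ... | inj₂ z≈r** = trans (reflexive (Eq.sym (Eq.trans z≈r** (*-involutive r)))) (x∧y≤x s _)
          ... | inj₁ z∈Q with downClosed Q (Bad⇒∧∈S bad) s∧r≤z z∈Q
          ...   | inj₁ s∧r∈Q = contradiction s∧r∈Q (Bad⇒∧∉Q bad)
          ...   | inj₂ s∧r≈z* =
            trans (≤*-swap (x∧y≤y s _)) (trans (reflexive (Eq.sym s∧r≈z*)) (x∧y≤x s r))

      -- Here `(s ∧ r) ∧ q` is `r ∧ (s ∧ q)` with `s ∧ q` below `s`. If `r` and `s ∧ q` have their
      -- join in `S`, that join is bad, so by maximality `s ∧ q` lies below `r`; otherwise
      -- submodularity gives the meet.
      maximalBad⇒closelyRelated : ∀ {r} → Bad r → (∀ {x} → Bad x → r ≤ x → x ≤ r) →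
                                  CloselyRelated (s ∧ r) P
      maximalBad⇒closelyRelated {r} bad max = s∧r∈P , λ {q} q∈P →
        S-resp-≈ (x∧[y∧z]≈[y∧x]∧z r s q)
          (r∧q∈S (proj₂ close q∈P) (x∧y≤x s q))
        where
        s∧r∈P : s ∧ r ∈ ⟦ P ⟧
        s∧r∈P = [ id
                , (λ s∧r≈s* → contradiction (∈-resp-≈ Q (Eq.sym s∧r≈s*) *∈Q) (Bad⇒∧∉Q bad)) ]′
          (downClosed P (Bad⇒∧∈S bad) (x∧y≤x s r) contained)
        r∧q∈S : ∀ {q} → q ∈ S → q ≤ s → r ∧ q ∈ S
        r∧q∈S {q} q∈S q≤s with submodular (Bad⇒∈S bad) q∈S
        ... | inj₂ r∧q∈S = r∧q∈S
        ... | inj₁ r∨q∈S = S-resp-≈ (antisym (∧-greatest q≤r refl) (x∧y≤y r q)) q∈S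
          where
          q≤r : q ≤ r
          q≤r = trans (y≤x∨y r q) (max (Bad-∨ bad q≤s r∨q∈S) (x≤x∨y r q))

      -- For a maximal bad `r`, the meet `s ∧ r` competes with `s`, so leastness gives `s ≤ r`. Then
      -- `s ∨ r` is `r`, which is in `S`.
      ¬Bad : ∀ {r} → ¬ Bad r
      ¬Bad bad with r , bad , max ← minimal
          (λ r → (_∈P? Q (r *)) ×-dec ¬? ((s ∨ r) ∈S?))
          (λ r≈r′ (r*∈Q , s∨r∉S) → ∈-resp-≈ Q (*-cong r≈r′) r*∈Q ,
            s∨r∉S ∘ S-resp-≈ (∨-cong joinSemilattice Eq.refl (Eq.sym r≈r′)))
          Bad⇒∈S (Flip.isPreorder isPreorder) (flip _≤?_) bad
        = proj₂ bad (S-resp-≈ (antisym (y≤x∨y s r) (∨-least s≤r refl)) (Bad⇒∈S bad))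
        where
        s≤r : s ≤ r
        s≤r = trans (least (maximalBad⇒closelyRelated bad max) (Bad⇒∧∉Q bad)) (x∧y≤y s r)

    *-close : CloselyRelated (s *) Q
    *-close = *∈Q , λ {r} r∈Q →
      let s∨r*∈S = decidable-stable ((s ∨ r *) ∈S?)
            λ s∨r*∉S → ¬Bad (∈-resp-≈ Q (Eq.sym (*-involutive r)) r∈Q , s∨r*∉S)
      in S-resp-≈ (deMorgan′ s r) (S-closed-* s∨r*∈S)

  open Least

  -- A maximal element of `P` outside `Q` shows that there are candidates. They are closed under
  -- meets, so a minimal one is least.
  Least-exists : ∀ (P Q : Profile 𝐒) → P ≠ Q → ∃ (Least P Q)
  Least-exists P Q P≠Q with separate P Q
  ... | inj₂ P≐Q = contradiction P≐Q P≠Q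
  ... | inj₁ (s , s∈P , s∉Q) = m , record
    { close = m-close ; avoid = m∉Q
    ; least = λ {x} x-close x∉Q → trans
        (min (∧-closelyRelated P P m-close x-close (proj₁ m-close)
             , ∉⇒∧∉ Q (∈⇒∈S P (proj₁ m-close)) (∈⇒∈S P (proj₁ x-close)) m∉Q x∉Q)
             (x∧y≤x m x))
        (x∧y≤y m x) }
    where
    maximum : ∃[ m ] ((m ∈ ⟦ P ⟧ × m ∉ ⟦ Q ⟧) × (∀ {x} → x ∈ ⟦ P ⟧ × x ∉ ⟦ Q ⟧ → m ≤ x → x ≤ m))
    maximum = minimal (λ s → (_∈P? P s) ×-dec ¬? (_∈P? Q s))
      (λ r≈s (r∈P , r∉Q) → ∈-resp-≈ P r≈s r∈P , r∉Q ∘ ∈-resp-≈ Q (Eq.sym r≈s))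
      (∈⇒∈S P ∘ proj₁) (Flip.isPreorder isPreorder) (flip _≤?_) (s∈P , s∉Q)
    minimum : ∃[ m ] ((CloselyRelated m P × m ∉ ⟦ Q ⟧) ×
                      (∀ {x} → CloselyRelated x P × x ∉ ⟦ Q ⟧ → x ≤ m → m ≤ x))
    minimum = let _ , (m∈P , m∉Q) , max = maximum in
      minimal (λ s → CloselyRelated? P s ×-dec ¬? (_∈P? Q s))
      (λ r≈s (r∈C , r∉Q) → CloselyRelated-resp-≈ P r≈s r∈C , r∉Q ∘ ∈-resp-≈ Q (Eq.sym r≈s))
      (∈⇒∈S P ∘ proj₁ ∘ proj₁) isPreorder _≤?_ (maximal⇒closelyRelated P Q m∈P m∉Q max , m∉Q)
    m : Carrier
    m = proj₁ minimum
    m-close : CloselyRelated m P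
    m-close = proj₁ (proj₁ (proj₂ minimum))
    m∉Q : m ∉ ⟦ Q ⟧
    m∉Q = proj₂ (proj₁ (proj₂ minimum))
    min : ∀ {x} → CloselyRelated x P × x ∉ ⟦ Q ⟧ → x ≤ m → m ≤ x
    min = proj₂ (proj₂ minimum)

  Least-resp-≈ : Least P Q r → r ≈ s → Least P Q s
  Least-resp-≈ {P} {Q} l r≈s = record
    { close = CloselyRelated-resp-≈ P r≈s (close l)
    ; avoid = avoid l ∘ ∈-resp-≈ Q (Eq.sym r≈s)
    ; least = λ x-close x∉Q → trans (reflexive (Eq.sym r≈s)) (least l x-close x∉Q)
    }

  Least? : ∀ (P Q : Profile 𝐒) → Unary.Decidable (Least P Q)
  Least? P Q s = map′ toLeast
    (λ l → (close l , avoid l) , λ _ (x-close , x∉Q) → least l x-close x∉Q)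
    ((CloselyRelated? P s ×-dec ¬? (_∈P? Q s)) ×-dec
     ∀S? {A = λ x → CloselyRelated x P × x ∉ ⟦ Q ⟧ → s ≤ x}
       (λ x → (CloselyRelated? P x ×-dec ¬? (_∈P? Q x)) →-dec (s ≤? x))
       (λ x≈y f (y-close , y∉Q) → trans
         (f (CloselyRelated-resp-≈ P (Eq.sym x≈y) y-close , y∉Q ∘ ∈-resp-≈ Q x≈y))
         (reflexive x≈y)))
    where
    toLeast : (CloselyRelated s P × s ∉ ⟦ Q ⟧) ×
              (∀ {x} → x ∈ S → CloselyRelated x P × x ∉ ⟦ Q ⟧ → s ≤ x) → Least P Q s
    toLeast ((close , avoid) , lower) = record
      { close = close ; avoid = avoid
      ; least = λ x-close x∉Q → lower (∈⇒∈S P (proj₁ x-close)) (x-close , x∉Q) }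

  -- Isolated profiles and comparability.

  -- R ≐ P is allowed for, as 𝒫 may list the same profile several times.
  Isolates : List (Profile 𝐒) → Profile 𝐒 → Carrier → Set (c ⊔ ℓ₁ ⊔ ℓ₂ ⊔ suc p)
  Isolates 𝒫 P a =
    Any (λ P′ → Least P′ P a) 𝒫 × All (λ R → ⟦ R ⟧ ≐ ⟦ P ⟧ ⊎ a ∈ ⟦ R ⟧) 𝒫

  Isolates-resp-≈ : Isolates 𝒫 P Respects _≈_
  Isolates-resp-≈ {P = P} r≈s (near , others) =
    Any.map (λ l → Least-resp-≈ l r≈s) near ,
    All.map (λ {R} → Sum.map₂ (∈-resp-≈ R r≈s)) others

  Isolates-resp-≐ : ⟦ P ⟧ ≐ ⟦ Q ⟧ → Isolates 𝒫 P s → Isolates 𝒫 Q s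
  Isolates-resp-≐ {P = P} {Q = Q} P≐Q@(P⊆Q , Q⊆P) (near , others) =
    Any.map (λ l → record
      { close = close l ; avoid = avoid l ∘ Q⊆P
      ; least = λ x-close x∉Q → least l x-close (x∉Q ∘ P⊆Q) }) near ,
    All.map (Sum.map₁ λ R≐P → ≐-trans R≐P P≐Q) others

  Isolates? : ∀ 𝒫 P → Unary.Decidable (Isolates 𝒫 P)
  Isolates? 𝒫 P a =
    Any.any? (λ P′ → Least? P′ P a) 𝒫 ×-dec All.all? (λ R → (R ≐? P) ⊎-dec (_∈P? R a)) 𝒫

  Isolates⇒∈S : Isolates 𝒫 P Unary.⊆ S
  Isolates⇒∈S (near , _) = let _ , _ , l = find near in s∈S l

  Isolated : List (Profile 𝐒) → Profile 𝐒 → Set (c ⊔ ℓ₁ ⊔ ℓ₂ ⊔ suc p)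
  Isolated 𝒫 P = ∃ (Isolates 𝒫 P)

  Isolated? : ∀ 𝒫 → Unary.Decidable (Isolated 𝒫)
  Isolated? 𝒫 P = ∃S? (Isolates? 𝒫 P) Isolates-resp-≈ Isolates⇒∈S

  isolates-other : Isolates 𝒫 P s → R ∈ˡ 𝒫 → R ≠ P → s ∈ ⟦ R ⟧
  isolates-other (_ , others) R∈𝒫 R≠P =
    [ (λ R≐P → contradiction R≐P R≠P) , id ]′ (All.lookup others R∈𝒫)

  isolates-avoid : Isolates 𝒫 P s → s ∉ ⟦ P ⟧
  isolates-avoid (near , _) = let _ , _ , l = find near in avoid l

  isolates-*∈ : Isolates 𝒫 P s → s * ∈ ⟦ P ⟧
  isolates-*∈ (near , _) = let _ , _ , l = find near in *∈Q l

  -- Let `a` be minimal among all m(X,Y), realised as m(P′,P). If `a` also missed some `Q` other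
  -- than `P`, then b = m(P,Q) and c = m(Q,P) would violate the consistency of `P′`.
  isolated-exists : P ∈ˡ 𝒫 → Q ∈ˡ 𝒫 → P ≠ Q → ∃[ R ] (R ∈ˡ 𝒫 × Isolated 𝒫 R)
  isolated-exists {P₀} {𝒫} {Q₀} P₀∈𝒫 Q₀∈𝒫 P₀≠Q₀ =
    let P′ , P′∈𝒫 , any = find (proj₁ (proj₂ leastMember))
        P , P∈𝒫 , l = find any
    in P , P∈𝒫 , a , lose P′∈𝒫 l ,
       All.tabulate (λ {Q} Q∈𝒫 → dichotomy P′∈𝒫 P∈𝒫 l Q∈𝒫)
    where
    LeastIn : Pred Carrier _
    LeastIn a = Any (λ P′ → Any (λ P → Least P′ P a) 𝒫) 𝒫
    leastMember : ∃[ a ] (LeastIn a × (∀ {y} → LeastIn y → y ≤ a → a ≤ y))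
    leastMember = minimal
      (λ a → Any.any? (λ P′ → Any.any? (λ P → Least? P′ P a) 𝒫) 𝒫)
      (λ r≈s → Any.map (Any.map (λ l → Least-resp-≈ l r≈s)))
      (λ any → let _ , _ , any′ = find any ; _ , _ , l = find any′ in s∈S l)
      isPreorder _≤?_
      (lose P₀∈𝒫 (lose Q₀∈𝒫 (proj₂ (Least-exists P₀ Q₀ P₀≠Q₀))))
    a : Carrier
    a = proj₁ leastMember
    min : ∀ {X Y y} → X ∈ˡ 𝒫 → Y ∈ˡ 𝒫 → Least X Y y → y ≤ a → a ≈ y
    min X∈𝒫 Y∈𝒫 l y≤a = antisym (proj₂ (proj₂ leastMember) (lose X∈𝒫 (lose Y∈𝒫 l)) y≤a) y≤a
    dichotomy : ∀ {P′ P Q} → P′ ∈ˡ 𝒫 → P ∈ˡ 𝒫 → Least P′ P a → Q ∈ˡ 𝒫 → ⟦ Q ⟧ ≐ ⟦ P ⟧ ⊎ a ∈ ⟦ Q ⟧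
    dichotomy {P′} {P} {Q} P′∈𝒫 P∈𝒫 l Q∈𝒫 with Q ≐? P | _∈P? Q a
    ... | yes Q≐P | _       = inj₁ Q≐P
    ... | no _    | yes a∈Q = inj₂ a∈Q
    -- If `b` were in `P′`, then `b ≤ a`, and minimality would identify `a`, which `P` omits, with
    -- `b`, which it contains; similarly for `c` and `Q`. So `P′` contains `c *` but not `b`,
    -- although `b ≤ c *`.
    ... | no Q≠P  | no a∉Q
      with b , lᵇ ← Least-exists P Q (Q≠P ∘ swap) | c , lᶜ ← Least-exists Q P Q≠P
      = [ (λ b∈P′ → contradiction b∈P′ b∉P′)
        , (λ b≈c** → contradiction (∈-resp-≈ P (Eq.trans b≈c** (*-involutive c)) (contained lᵇ))
                                   (avoid lᶜ)) ]′
        (downClosed P′ (s∈S lᵇ) b≤c* (∉⇒*∈ P′ (s∈S lᶜ) c∉P′))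
      where
      b∉P′ : b ∉ ⟦ P′ ⟧
      b∉P′ b∈P′ = avoid l (∈-resp-≈ P
        (Eq.sym (min P∈𝒫 Q∈𝒫 lᵇ (least-via lᵇ P′ (close l) b∈P′ a∉Q))) (contained lᵇ))
      c∉P′ : c ∉ ⟦ P′ ⟧
      c∉P′ c∈P′ = a∉Q (∈-resp-≈ Q
        (Eq.sym (min Q∈𝒫 P∈𝒫 lᶜ (least-via lᶜ P′ (close l) c∈P′ (avoid l)))) (contained lᶜ))
      b≤c* : b ≤ c *
      b≤c* = least-via lᵇ P (*-close lᶜ) (contained lᵇ) (*∉ Q P (contained lᶜ) (avoid lᶜ))

  -- Goodness with its two profiles named; the last component makes them differ and rules out
  -- degenerate `s`.
  Cuts : Profile 𝐒 → Profile 𝐒 → Carrier → Set (c ⊔ p)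
  Cuts P Q s = CloselyRelated s P × CloselyRelated (s *) Q × s ∉ ⟦ Q ⟧

  Least⇒Cuts : Least P Q s → Cuts P Q s
  Least⇒Cuts l = close l , *-close l , avoid l

  Cuts-* : Cuts P Q (s *) → Cuts Q P s
  Cuts-* {P} {Q} {s} (s*-close , s**-close , s*∉Q) =
    s-close , s*-close ,
    λ s∈P → *∉ P Q (proj₁ s*-close) s*∉Q (∈-resp-≈ P (Eq.sym (*-involutive s)) s∈P)
    where
    s-close : CloselyRelated s Q
    s-close = CloselyRelated-resp-≈ Q (*-involutive s) s**-close

  -- The isolating `s` lies in both `Q` and `R`, so it can be compared with `t` through `Q` or with
  -- `t *` through `R`, whichever `P` omits.
  isolates-comparable : Isolates 𝒫 P s → Q ∈ˡ 𝒫 → R ∈ˡ 𝒫 → Q ≠ P → R ≠ P → Cuts Q R t →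
                        s ≤ t ⊎ s ≤ t *
  isolates-comparable {𝒫} {P} {s} {Q} {R} {t} i@(near , _) Q∈𝒫 R∈𝒫 Q≠P R≠P (t-close , t*-close , t∉R)
    with _ , _ , l ← find near | _∈P? P t
  ... | no t∉P  = inj₁ (least-via l Q t-close (isolates-other i Q∈𝒫 Q≠P) t∉P)
  ... | yes t∈P = inj₂ (least-via l R t*-close (isolates-other i R∈𝒫 R≠P) (*∉ P R t∈P t∉R))

  -- For the same isolated profile the comparison runs through the profile from which `t` comes. For
  -- different ones it runs through `Q`, to which `t *` is closely related.
  isolates-isolates : P ∈ˡ 𝒫 → Q ∈ˡ 𝒫 → Isolates 𝒫 P s → Isolates 𝒫 Q t → s ≤ t ⊎ s ≤ t *
  isolates-isolates {P} {𝒫} {Q} {s} {t} P∈𝒫 Q∈𝒫 i@(nearₛ , _) j@(nearₜ , _)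
    with _ , _ , lₛ ← find nearₛ | Q′ , Q′∈𝒫 , lₜ ← find nearₜ | Q ≐? P
  ... | yes Q≐P = inj₁ (least-via lₛ Q′ (close lₜ)
          (isolates-other i Q′∈𝒫 λ Q′≐P → avoid lₜ (proj₂ Q≐P (proj₁ Q′≐P (contained lₜ))))
          (avoid lₜ ∘ proj₂ Q≐P))
  ... | no Q≠P  = inj₂ (least-via lₛ Q (*-close lₜ) (isolates-other i Q∈𝒫 Q≠P)
          (*∉ P Q (isolates-other j P∈𝒫 (Q≠P ∘ swap)) (avoid lₜ)))

  -- Iterated construction of the nested set.

  rest : List (Profile 𝐒) → List (Profile 𝐒)
  rest 𝒫 = filter (λ P → ¬? (Isolated? 𝒫 P)) 𝒫

  ∈-rest⁺ : P ∈ˡ 𝒫 → ¬ Isolated 𝒫 P → P ∈ˡ rest 𝒫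
  ∈-rest⁺ {𝒫 = 𝒫} = ∈-filter⁺ (λ P → ¬? (Isolated? 𝒫 P))

  ∈-rest⁻ : P ∈ˡ rest 𝒫 → P ∈ˡ 𝒫 × ¬ Isolated 𝒫 P
  ∈-rest⁻ {𝒫 = 𝒫} = ∈-filter⁻ (λ P → ¬? (Isolated? 𝒫 P))

  rest-shrinks : P ∈ˡ 𝒫 → Isolated 𝒫 P → length (rest 𝒫) <ℕ length 𝒫
  rest-shrinks {𝒫 = 𝒫} P∈𝒫 iso = filter-notAll (λ P → ¬? (Isolated? 𝒫 P)) 𝒫
    (lose P∈𝒫 (contradiction iso))

  -- Being inductive, this needs no count of stages: once no profile is isolated, `rest` changes
  -- nothing and `later` alone produces no element.
  data InN (𝒫 : List (Profile 𝐒)) (s : Carrier) : Set (c ⊔ ℓ₁ ⊔ ℓ₂ ⊔ suc p) where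
    now   : P ∈ˡ 𝒫 → Isolates 𝒫 P s ⊎ Isolates 𝒫 P (s *) → InN 𝒫 s
    later : InN (rest 𝒫) s → InN 𝒫 s

  InN-resp-∼ : r ∼ s → InN 𝒫 r → InN 𝒫 s
  InN-resp-∼ r∼s (later h) = later (InN-resp-∼ r∼s h)
  InN-resp-∼ {r} {s} (inj₁ r≈s) (now P∈𝒫 i) =
    now P∈𝒫 (Sum.map (Isolates-resp-≈ r≈s) (Isolates-resp-≈ (*-cong r≈s)) i)
  InN-resp-∼ {r} {s} (inj₂ r≈s*) (now P∈𝒫 i) =
    now P∈𝒫 (Sum.swap (Sum.map (Isolates-resp-≈ r≈s*) (Isolates-resp-≈ (Eq.sym (≈*-swap r≈s*))) i))

  -- Gives goodness, and for nestedness a pair of profiles that survived all earlier stages.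
  InN⇒Cuts : InN 𝒫 s → ∃[ P ] ∃[ Q ] (P ∈ˡ 𝒫 × Q ∈ˡ 𝒫 × Cuts P Q s)
  InN⇒Cuts (now P∈𝒫 (inj₁ (near , _))) =
    let P′ , P′∈𝒫 , l = find near in P′ , _ , P′∈𝒫 , P∈𝒫 , Least⇒Cuts l
  InN⇒Cuts (now {P = P} P∈𝒫 (inj₂ (near , _))) =
    let P′ , P′∈𝒫 , l = find near in P , P′ , P∈𝒫 , P′∈𝒫 , Cuts-* {P = P′} {Q = P} (Least⇒Cuts l)
  InN⇒Cuts (later h) =
    let P , Q , P∈ , Q∈ , cuts = InN⇒Cuts h in
    P , Q , proj₁ (∈-rest⁻ P∈) , proj₁ (∈-rest⁻ Q∈) , cuts

  InN⇒∈S : InN 𝒫 s → s ∈ S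
  InN⇒∈S h = let P , _ , _ , _ , (s∈P , _) , _ = InN⇒Cuts h in ∈⇒∈S P s∈P

  InN⇒Good : InN 𝒫 s → Good 𝒫 s
  InN⇒Good h = let P , Q , P∈𝒫 , Q∈𝒫 , s-close , s*-close , s∉Q = InN⇒Cuts h in
    P , Q , P∈𝒫 , Q∈𝒫 , (λ (P⊆Q , _) → s∉Q (P⊆Q (proj₁ s-close))) , s-close , s*-close

  private
    ≤-or-≤*-flip : s ≤ t * ⊎ s ≤ t * * → s ≤ t ⊎ s ≤ t *
    ≤-or-≤*-flip = [ inj₂ , (λ s≤t** → inj₁ (trans s≤t** (**≤ _))) ]′

    comparable⇒Nested : r ∼ s → s ≤ t ⊎ s ≤ t * → Nested r t
    comparable⇒Nested {s = s} {t} r∼s (inj₁ s≤t)  = s , t , ∼-sym r∼s , inj₁ Eq.refl , inj₁ s≤t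
    comparable⇒Nested {s = s} {t} r∼s (inj₂ s≤t*) = s , t * , ∼-sym r∼s , inj₂ Eq.refl , inj₁ s≤t*

  isolates-InN : P ∈ˡ 𝒫 → Isolates 𝒫 P s → InN 𝒫 t → s ≤ t ⊎ s ≤ t *
  isolates-InN P∈𝒫 i (now Q∈𝒫 (inj₁ j)) = isolates-isolates P∈𝒫 Q∈𝒫 i j
  isolates-InN P∈𝒫 i (now Q∈𝒫 (inj₂ j)) = ≤-or-≤*-flip (isolates-isolates P∈𝒫 Q∈𝒫 i j)
  -- The two profiles cut by a later element are not isolated, so neither of them is `P`.
  isolates-InN {P} {𝒫} {s} P∈𝒫 i@(near , others) (later h)
    with Q , R , Q∈ , R∈ , cuts ← InN⇒Cuts h =
    isolates-comparable i (proj₁ (∈-rest⁻ Q∈)) (proj₁ (∈-rest⁻ R∈)) (distinct Q∈) (distinct R∈) cuts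
    where
    distinct : ∀ {Q} → Q ∈ˡ rest 𝒫 → Q ≠ P
    distinct Q∈ Q≐P = proj₂ (∈-rest⁻ Q∈) (_ , Isolates-resp-≐ (swap Q≐P) i)

  private
    now-nested : P ∈ˡ 𝒫 → Isolates 𝒫 P r ⊎ Isolates 𝒫 P (r *) → InN 𝒫 s → Nested r s
    now-nested P∈𝒫 (inj₁ i) k = comparable⇒Nested (inj₁ Eq.refl) (isolates-InN P∈𝒫 i k)
    now-nested P∈𝒫 (inj₂ i) k = comparable⇒Nested (∼-sym (inj₂ Eq.refl)) (isolates-InN P∈𝒫 i k)

  InN-nested : InN 𝒫 r → InN 𝒫 s → Nested r s
  InN-nested (later h)     (later k)     = InN-nested h k
  InN-nested (now P∈𝒫 i)   k             = now-nested P∈𝒫 i k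
  InN-nested h@(later _)   (now P∈𝒫 i)   = Nested-sym (now-nested P∈𝒫 i h)

  InN? : ∀ 𝒫 → Unary.Decidable (InN 𝒫)
  InN? 𝒫 = go 𝒫 (<-wellFounded (length 𝒫))
    where
    go : ∀ 𝒫 → Acc _<ℕ_ (length 𝒫) → Unary.Decidable (InN 𝒫)
    go 𝒫 (acc rec) s with Any.any? (Isolated? 𝒫) 𝒫
    ... | no none = no stuck
      where
      rest≡ : rest 𝒫 ≡ 𝒫
      rest≡ = filter-all (λ P → ¬? (Isolated? 𝒫 P)) (¬Any⇒All¬ 𝒫 none)
      -- `rest 𝒫` equals `𝒫` only propositionally; the variable index keeps the recursion structural
      -- in the derivation.
      stuck′ : ∀ {𝒬} → 𝒬 ≡ 𝒫 → ¬ InN 𝒬 s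
      stuck′ ≡.refl (now P∈𝒫 i) = none (lose P∈𝒫 ([ (λ j → _ , j) , (λ j → _ , j) ]′ i))
      stuck′ ≡.refl (later h) = stuck′ rest≡ h
      stuck : ¬ InN 𝒫 s
      stuck = stuck′ ≡.refl
    ... | yes any = map′
      [ (λ any → let _ , P∈𝒫 , i = find any in now P∈𝒫 i) , later ]′
      (λ where (now P∈𝒫 i) → inj₁ (lose P∈𝒫 i) ; (later h) → inj₂ h)
      (Any.any? (λ P → Isolates? 𝒫 P s ⊎-dec Isolates? 𝒫 P (s *)) 𝒫 ⊎-dec
       go (rest 𝒫) (rec (let _ , P∈𝒫 , iso = find any in rest-shrinks P∈𝒫 iso)) s)

  Distinguished : List (Profile 𝐒) → Profile 𝐒 → Profile 𝐒 → Set _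
  Distinguished 𝒫 P Q = ∃[ s ] (InN 𝒫 s × ¬ Degenerate s × OrientedDifferently s P Q)

  -- If one of the two profiles is isolated, its isolating separation distinguishes them. Otherwise
  -- both survive, while some other profile is removed and the list shrinks.
  InN-distinguishes : ∀ 𝒫 → P ∈ˡ 𝒫 → Q ∈ˡ 𝒫 → P ≠ Q → Distinguished 𝒫 P Q
  InN-distinguishes 𝒫 = go 𝒫 (<-wellFounded (length 𝒫))
    where
    nondegenerate : ∀ {P s} → s ∉ ⟦ P ⟧ → s * ∈ ⟦ P ⟧ → ¬ Degenerate s
    nondegenerate {P} s∉P s*∈P deg = s∉P (∈-resp-≈ P (Eq.sym deg) s*∈P)
    go : ∀ 𝒫 → Acc _<ℕ_ (length 𝒫) → ∀ {P Q} → P ∈ˡ 𝒫 → Q ∈ˡ 𝒫 → P ≠ Q → Distinguished 𝒫 P Q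
    go 𝒫 (acc rec) {P} {Q} P∈𝒫 Q∈𝒫 P≠Q with Isolated? 𝒫 P | Isolated? 𝒫 Q
    ... | yes (s , i) | _ = s , now P∈𝒫 (inj₁ i) ,
          nondegenerate {P} (isolates-avoid i) (isolates-*∈ i) ,
          inj₂ (isolates-*∈ i , isolates-other i Q∈𝒫 (P≠Q ∘ swap))
    ... | no _ | yes (s , i) = s , now Q∈𝒫 (inj₁ i) ,
          nondegenerate {Q} (isolates-avoid i) (isolates-*∈ i) ,
          inj₁ (isolates-other i P∈𝒫 P≠Q , isolates-*∈ i)
    ... | no P-not | no Q-not =
          let _ , R∈𝒫 , iso = isolated-exists P∈𝒫 Q∈𝒫 P≠Q
              s , h , rem = go (rest 𝒫) (rec (rest-shrinks R∈𝒫 iso))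
                              (∈-rest⁺ P∈𝒫 P-not) (∈-rest⁺ Q∈𝒫 Q-not) P≠Q
          in s , later h , rem

  -- InN 𝒫 lives in too large a universe to serve as a set of separations, so its decision
  -- procedure is used instead.
  N : List (Profile 𝐒) → SeparationSet 𝐒
  N 𝒫 = record
    { set    = λ s → Lift p (True (InN? 𝒫 s))
    ; set⊆S  = InN⇒∈S ∘ toWitness ∘ lower
    ; resp-∼ = λ r∼s h → lift (fromWitness (InN-resp-∼ r∼s (toWitness (lower h))))
    }

  ∈N⇒InN : s ∈ orientations (N 𝒫) → InN 𝒫 s
  ∈N⇒InN = toWitness ∘ lower

  InN⇒∈N : InN 𝒫 s → s ∈ orientations (N 𝒫)
  InN⇒∈N = lift ∘ fromWitness

-- Invariance under correspondences.

-- An isomorphism as a relation, so that each preservation lemma also gives its converse by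
-- reversal.
record Correspondence (𝐒 𝐒′ : SubmodularSystem c ℓ₁ ℓ₂ p) ℓ : Set (c ⊔ ℓ₁ ⊔ ℓ₂ ⊔ p ⊔ suc ℓ) where
  private
    module A = SubmodularSystem 𝐒
    module B = SubmodularSystem 𝐒′
  infix 4 _↔_
  field
    _↔_   : A.Carrier → B.Carrier → Set ℓ
    to    : ∀ {a} → a ∈ A.S → ∃[ b ] a ↔ b
    from  : ∀ {b} → b ∈ B.S → ∃[ a ] a ↔ b
    ≤⇔    : ∀ {a b r s} → a ↔ b → r ↔ s → (a A.≤ r) ⇔ (b B.≤ s)
    *-↔   : ∀ {a b} → a ↔ b → (a A.*) ↔ (b B.*)
    -- Meets outside `S` need not have counterparts, so only membership in `S` is compared.
    ∧∈⇔   : ∀ {a b r s} → a ↔ b → r ↔ s → (a A.∧ r ∈ A.S) ⇔ (b B.∧ s ∈ B.S)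

  infix 4 _↭_ _≋_
  _↭_ : Profile 𝐒 → Profile 𝐒′ → Set _
  P ↭ P′ = ∀ {a b} → a ↔ b → (a ∈ ⟦ P ⟧) ⇔ (b ∈ ⟦ P′ ⟧)

  _≋_ : List (Profile 𝐒) → List (Profile 𝐒′) → Set _
  𝒫 ≋ 𝒫′ = (∀ {P}  → P  ∈ˡ 𝒫  → ∃[ P′ ] (P′ ∈ˡ 𝒫′ × P ↭ P′))
         × (∀ {P′} → P′ ∈ˡ 𝒫′ → ∃[ P ]  (P  ∈ˡ 𝒫  × P ↭ P′))

private
  variable
    𝐒 𝐒′ : SubmodularSystem c ℓ₁ ℓ₂ p

  ⇔-sym : ∀ {a b} {X : Set a} {Y : Set b} → X ⇔ Y → Y ⇔ X
  ⇔-sym e = mk⇔ (Equivalence.from e) (Equivalence.to e)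

reverse : Correspondence 𝐒 𝐒′ ℓ → Correspondence 𝐒′ 𝐒 ℓ
reverse 𝐂 = record
  { _↔_ = flip _↔_ ; to = from ; from = to
  ; ≤⇔ = λ x y → ⇔-sym (≤⇔ x y) ; *-↔ = *-↔ ; ∧∈⇔ = λ x y → ⇔-sym (∧∈⇔ x y) }
  where open Correspondence 𝐂

module ProfilePreservation {𝐒 𝐒′ : SubmodularSystem c ℓ₁ ℓ₂ p} (𝐂 : Correspondence 𝐒 𝐒′ ℓ) where
  open Correspondence 𝐂
  private
    module B = NestedSet 𝐒′
    open Equivalence renaming (to to ⇒; from to ⇐)

    variable
      a : SubmodularSystem.Carrier 𝐒
      b : SubmodularSystem.Carrier 𝐒′
      P Q : Profile 𝐒
      P′ Q′ : Profile 𝐒′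
      𝒫 : List (Profile 𝐒)
      𝒫′ : List (Profile 𝐒′)

  ↭-reverse : P ↭ P′ → Correspondence._↭_ (reverse 𝐂) P′ P
  ↭-reverse P↭P′ a↔b = ⇔-sym (P↭P′ a↔b)

  ≋-reverse : 𝒫 ≋ 𝒫′ → Correspondence._≋_ (reverse 𝐂) 𝒫′ 𝒫
  ≋-reverse (f , g) =
    (λ {P′} P′∈ → let P , P∈ , P↭P′ = g P′∈ in P , P∈ , λ {_} → ↭-reverse {P} {P′} P↭P′) ,
    (λ {P} P∈ → let P′ , P′∈ , P↭P′ = f P∈ in P′ , P′∈ , λ {_} → ↭-reverse {P} {P′} P↭P′)

  ⊆-preserved : P ↭ P′ → Q ↭ Q′ → ⟦ P ⟧ Unary.⊆ ⟦ Q ⟧ → ⟦ P′ ⟧ Unary.⊆ ⟦ Q′ ⟧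
  ⊆-preserved {P′ = P′} P↭P′ Q↭Q′ P⊆Q b∈P′ =
    let a , a↔b = from (B.∈⇒∈S P′ b∈P′) in ⇒ (Q↭Q′ a↔b) (P⊆Q (⇐ (P↭P′ a↔b) b∈P′))

  ≐-preserved : P ↭ P′ → Q ↭ Q′ → ⟦ P ⟧ ≐ ⟦ Q ⟧ → ⟦ P′ ⟧ ≐ ⟦ Q′ ⟧
  ≐-preserved {P} {P′} {Q} {Q′} P↭P′ Q↭Q′ (P⊆Q , Q⊆P) =
    ⊆-preserved {P} {P′} {Q} {Q′} P↭P′ Q↭Q′ P⊆Q , ⊆-preserved {Q} {Q′} {P} {P′} Q↭Q′ P↭P′ Q⊆P

  closelyRelated-preserved : a ↔ b → P ↭ P′ → CloselyRelated a P → CloselyRelated b P′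
  closelyRelated-preserved {P′ = P′} a↔b P↭P′ (a∈P , close) =
    ⇒ (P↭P′ a↔b) a∈P , λ {s} s∈P′ → let r , r↔s = from (B.∈⇒∈S P′ s∈P′) in
      ⇒ (∧∈⇔ a↔b r↔s) (close (⇐ (P↭P′ r↔s) s∈P′))

module LeastPreservation {𝐒 𝐒′ : SubmodularSystem c ℓ₁ ℓ₂ p} (𝐂 : Correspondence 𝐒 𝐒′ ℓ) where
  open Correspondence 𝐂
  open ProfilePreservation 𝐂 public
  private
    module A = NestedSet 𝐒
    module B = NestedSet 𝐒′
    module Rev = ProfilePreservation (reverse 𝐂)
    open Equivalence renaming (to to ⇒; from to ⇐)

    variable
      a : SubmodularSystem.Carrier 𝐒
      b : SubmodularSystem.Carrier 𝐒′
      P Q : Profile 𝐒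
      P′ Q′ : Profile 𝐒′
      𝒫 : List (Profile 𝐒)
      𝒫′ : List (Profile 𝐒′)

  -- Leastness quantifies over competitors in the target, which are first pulled back along the
  -- reversed correspondence.
  least-preserved : a ↔ b → P ↭ P′ → Q ↭ Q′ → A.Least P Q a → B.Least P′ Q′ b
  least-preserved {P = P} {P′} a↔b P↭P′ Q↭Q′ l = record
    { close = closelyRelated-preserved {P = P} {P′} a↔b P↭P′ (A.Least.close l)
    ; avoid = A.Least.avoid l ∘ ⇐ (Q↭Q′ a↔b)
    ; least = λ y-close y∉Q′ →
        let x , x↔y = from (B.∈⇒∈S P′ (proj₁ y-close)) in
        ⇒ (≤⇔ a↔b x↔y) (A.Least.least l
          (Rev.closelyRelated-preserved {P = P′} {P} x↔y (↭-reverse {P} {P′} P↭P′) y-close)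
          (y∉Q′ ∘ ⇒ (Q↭Q′ x↔y)))
    }

  isolates-preserved : 𝒫 ≋ 𝒫′ → a ↔ b → P ↭ P′ → A.Isolates 𝒫 P a → B.Isolates 𝒫′ P′ b
  isolates-preserved {P = P} {P′} (𝒫→𝒫′ , 𝒫′→𝒫) a↔b P↭P′ (near , others) =
    (let Q , Q∈𝒫 , l = find near ; Q′ , Q′∈𝒫′ , Q↭Q′ = 𝒫→𝒫′ Q∈𝒫 in
     lose Q′∈𝒫′ (least-preserved {P = Q} {Q′} {P} {P′} a↔b Q↭Q′ P↭P′ l)) ,
    All.tabulate λ {R′} R′∈𝒫′ → let R , R∈𝒫 , R↭R′ = 𝒫′→𝒫 R′∈𝒫′ in
      Sum.map (≐-preserved {R} {R′} {P} {P′} R↭R′ P↭P′) (⇒ (R↭R′ a↔b)) (All.lookup others R∈𝒫)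

  isolated-preserved : 𝒫 ≋ 𝒫′ → P ↭ P′ → A.Isolated 𝒫 P → B.Isolated 𝒫′ P′
  isolated-preserved {P = P} {P′} 𝒫≋𝒫′ P↭P′ (a , i) =
    let b , a↔b = to (A.Isolates⇒∈S i) in b , isolates-preserved {P = P} {P′} 𝒫≋𝒫′ a↔b P↭P′ i

module Preservation {𝐒 𝐒′ : SubmodularSystem c ℓ₁ ℓ₂ p} (𝐂 : Correspondence 𝐒 𝐒′ ℓ) where
  open Correspondence 𝐂
  open LeastPreservation 𝐂
  private
    module A = NestedSet 𝐒
    module B = NestedSet 𝐒′
    module Rev = LeastPreservation (reverse 𝐂)

    variable
      a : SubmodularSystem.Carrier 𝐒
      b : SubmodularSystem.Carrier 𝐒′
      𝒫 : List (Profile 𝐒)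
      𝒫′ : List (Profile 𝐒′)

  -- Survival is the negation of isolation, so each direction uses the transport of isolation the
  -- other way.
  rest-preserved : 𝒫 ≋ 𝒫′ → A.rest 𝒫 ≋ B.rest 𝒫′
  rest-preserved {𝒫} {𝒫′} 𝒫≋𝒫′@(𝒫→𝒫′ , 𝒫′→𝒫) =
    (λ {P} P∈ →
      let P∈𝒫 , P-not = A.∈-rest⁻ P∈
          P′ , P′∈𝒫′ , P↭P′ = 𝒫→𝒫′ P∈𝒫
      in P′ , B.∈-rest⁺ P′∈𝒫′ (P-not ∘ Rev.isolated-preserved {P = P′} {P} (≋-reverse 𝒫≋𝒫′)
                                        (↭-reverse {P} {P′} P↭P′)) , λ {_} → P↭P′) ,
    (λ {P′} P′∈ →
      let P′∈𝒫′ , P′-not = B.∈-rest⁻ P′∈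
          P , P∈𝒫 , P↭P′ = 𝒫′→𝒫 P′∈𝒫′
      in P , A.∈-rest⁺ P∈𝒫 (P′-not ∘ isolated-preserved {P = P} {P′} 𝒫≋𝒫′ P↭P′) , λ {_} → P↭P′)

  InN-preserved : 𝒫 ≋ 𝒫′ → a ↔ b → A.InN 𝒫 a → B.InN 𝒫′ b
  InN-preserved 𝒫≋𝒫′@(𝒫→𝒫′ , _) a↔b (A.now {P = P} P∈𝒫 i) =
    let P′ , P′∈𝒫′ , P↭P′ = 𝒫→𝒫′ P∈𝒫 in B.now P′∈𝒫′
      (Sum.map (isolates-preserved {P = P} {P′} 𝒫≋𝒫′ a↔b P↭P′)
               (isolates-preserved {P = P} {P′} 𝒫≋𝒫′ (*-↔ a↔b) P↭P′) i)
  InN-preserved 𝒫≋𝒫′ a↔b (A.later h) = B.later (InN-preserved (rest-preserved 𝒫≋𝒫′) a↔b h)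

-- From isomorphisms to correspondences.

module _ (𝐒 𝐒′ : SubmodularSystem c ℓ₁ ℓ₂ p)
         (iso : Isomorphism (SubmodularSystem.induced 𝐒) (SubmodularSystem.induced 𝐒′))
         (respectsJoins : RespectsJoins 𝐒 𝐒′ iso) where
  private
    module A = NestedSet 𝐒
    module B = NestedSet 𝐒′
    module 𝐀 = SubmodularSystem 𝐒
    module 𝐁 = SubmodularSystem 𝐒′
  open Isomorphism iso
  open IsOrderIsomorphism isOrderIsomorphism using (mono; cancel; injective; surjective)

  -- The graph of `φ` closed under `≈`, stated on bare elements to hide the membership proofs
  -- carried by `φ`.
  Graph : 𝐀.Carrier → 𝐁.Carrier → Set _
  Graph a b = Σ[ x ∈ Σ 𝐀.Carrier 𝐀.S ] (proj₁ x 𝐀.≈ a × proj₁ (φ x) 𝐁.≈ b)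

  private
    graph-* : ∀ {a b} → Graph a b → Graph (a 𝐀.*) (b 𝐁.*)
    graph-* ((x , x∈S) , x≈a , φx≈b) =
      (x 𝐀.* , 𝐀.S-closed-* x∈S) , A.*-cong x≈a , 𝐁.Eq.trans (φ-* (x , x∈S)) (B.*-cong φx≈b)

    graph-∨⇔ : ∀ {a b r s} → Graph a b → Graph r s → (a 𝐀.∨ r ∈ 𝐀.S) ⇔ (b 𝐁.∨ s ∈ 𝐁.S)
    graph-∨⇔ (x , x≈a , φx≈b) (y , y≈r , φy≈s) = mk⇔
      (𝐁.S-resp-≈ (∨-cong B.joinSemilattice φx≈b φy≈s) ∘ Equivalence.to (respectsJoins x y) ∘
       𝐀.S-resp-≈ (𝐀.Eq.sym (∨-cong A.joinSemilattice x≈a y≈r)))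
      (𝐀.S-resp-≈ (∨-cong A.joinSemilattice x≈a y≈r) ∘ Equivalence.from (respectsJoins x y) ∘
       𝐁.S-resp-≈ (𝐁.Eq.sym (∨-cong B.joinSemilattice φx≈b φy≈s)))

  correspondence : Correspondence 𝐒 𝐒′ _
  correspondence = record
    { _↔_   = Graph
    ; to    = λ {a} a∈S → proj₁ (φ (a , a∈S)) , (a , a∈S) , 𝐀.Eq.refl , 𝐁.Eq.refl
    ; from  = λ {b} b∈S → let x , φx≈ = surjective (b , b∈S) in
                proj₁ x , x , 𝐀.Eq.refl , φx≈ 𝐀.Eq.refl
    ; ≤⇔    = λ (x , x≈a , φx≈b) (y , y≈r , φy≈s) → mk⇔
        (λ a≤r → 𝐁.trans (𝐁.reflexive (𝐁.Eq.sym φx≈b)) (𝐁.trans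
          (mono {x} {y} (𝐀.trans (𝐀.reflexive x≈a) (𝐀.trans a≤r (𝐀.reflexive (𝐀.Eq.sym y≈r)))))
          (𝐁.reflexive φy≈s)))
        (λ b≤s → 𝐀.trans (𝐀.reflexive (𝐀.Eq.sym x≈a)) (𝐀.trans
          (cancel {x} {y} (𝐁.trans (𝐁.reflexive φx≈b) (𝐁.trans b≤s (𝐁.reflexive (𝐁.Eq.sym φy≈s)))))
          (𝐀.reflexive y≈r)))
    ; *-↔   = graph-*
    -- De Morgan turns meets into joins of inverses, which `respectsJoins` compares.
    ; ∧∈⇔   = λ a↔b r↔s → let ∨⇔ = graph-∨⇔ (graph-* a↔b) (graph-* r↔s) in mk⇔
        (B.*∨*∈S⇒∧∈S ∘ Equivalence.to ∨⇔ ∘ A.∧∈S⇒*∨*∈S)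
        (A.*∨*∈S⇒∧∈S ∘ Equivalence.from ∨⇔ ∘ B.∧∈S⇒*∨*∈S)
    }

  open Correspondence correspondence using (_↭_; _≋_; to; from)

  image⇒↭ : ∀ {P P′} → Image 𝐒 𝐒′ iso ⟦ P ⟧ ≐ ⟦ P′ ⟧ → P ↭ P′
  image⇒↭ {P} {P′} (image⊆P′ , P′⊆image) (x , x≈a , φx≈b) = mk⇔
    (λ a∈P → image⊆P′ (x , A.∈-resp-≈ P (𝐀.Eq.sym x≈a) a∈P , φx≈b))
    -- The preimage found in `P` need not be the given `x`; injectivity identifies the two.
    (λ b∈P′ → let y , y∈P , φy≈b = P′⊆image b∈P′ in
      A.∈-resp-≈ P (𝐀.Eq.trans (injective {y} {x} (𝐁.Eq.trans φy≈b (𝐁.Eq.sym φx≈b))) x≈a) y∈P)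

  isImageOf⇒≋ : ∀ {𝒫 𝒫′} → IsImageOf 𝐒 𝐒′ iso 𝒫′ 𝒫 → 𝒫 ≋ 𝒫′
  isImageOf⇒≋ (f , g) =
    (λ {P} P∈ → let P′ , P′∈ , eq = f P∈ in P′ , P′∈ , λ {_} → image⇒↭ {P} {P′} eq) ,
    (λ {P′} P′∈ → let P , P∈ , eq = g P′∈ in P , P∈ , λ {_} → image⇒↭ {P} {P′} eq)

  N-image : ∀ 𝒫 𝒫′ → IsImageOf 𝐒 𝐒′ iso 𝒫′ 𝒫 →
            Image 𝐒 𝐒′ iso (orientations (A.N 𝒫)) ≐ orientations (B.N 𝒫′)
  N-image 𝒫 𝒫′ image =
    (λ (x , x∈N , φx≈t) → B.InN⇒∈N (Preservation.InN-preserved correspondence 𝒫≋𝒫′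
      (x , 𝐀.Eq.refl , φx≈t) (A.∈N⇒InN x∈N))) ,
    (λ t∈N → let x , φx≈ = surjective (_ , orientations⊆ t∈N) in
      x , A.InN⇒∈N (Preservation.InN-preserved (reverse correspondence)
            (ProfilePreservation.≋-reverse correspondence 𝒫≋𝒫′)
            (x , 𝐀.Eq.refl , φx≈ 𝐀.Eq.refl) (B.∈N⇒InN t∈N)) ,
      φx≈ 𝐀.Eq.refl)
    where
    𝒫≋𝒫′ : 𝒫 ≋ 𝒫′
    𝒫≋𝒫′ = isImageOf⇒≋ image
    orientations⊆ : ∀ {t} → t ∈ orientations (B.N 𝒫′) → t ∈ 𝐁.S
    orientations⊆ = B.InN⇒∈S ∘ B.∈N⇒InN

theorem5p8 : ∀ {c ℓ₁ ℓ₂ p} →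
    Σ[ N ∈ ((𝐒 : SubmodularSystem c ℓ₁ ℓ₂ p) → List (Profile 𝐒) → SeparationSet 𝐒) ]
      ( (∀ 𝐒 (𝒫 : List (Profile 𝐒)) →
          IsNested (N 𝐒 𝒫) × DistinguishesAll (N 𝐒 𝒫) 𝒫 × ContainsOnlyGood (N 𝐒 𝒫) 𝒫)
      × (∀ (𝐒 𝐒′ : SubmodularSystem c ℓ₁ ℓ₂ p)
           (φ : Isomorphism (SubmodularSystem.induced 𝐒) (SubmodularSystem.induced 𝐒′)) →
          RespectsJoins 𝐒 𝐒′ φ →
          ∀ (𝒫 : List (Profile 𝐒)) (𝒫′ : List (Profile 𝐒′)) →
          IsImageOf 𝐒 𝐒′ φ 𝒫′ 𝒫 →
          Image 𝐒 𝐒′ φ (orientations (N 𝐒 𝒫)) ≐ orientations (N 𝐒′ 𝒫′)) )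
theorem5p8 = NestedSet.N
  , (λ 𝐒 𝒫 → let open NestedSet 𝐒 in
      (λ r∈N s∈N → InN-nested (∈N⇒InN {𝒫 = 𝒫} r∈N) (∈N⇒InN {𝒫 = 𝒫} s∈N))
    , (λ P∈𝒫 Q∈𝒫 P≠Q → let s , s∈N , rem = InN-distinguishes 𝒫 P∈𝒫 Q∈𝒫 P≠Q in
        s , InN⇒∈N s∈N , rem)
    , InN⇒Good ∘ ∈N⇒InN {𝒫 = 𝒫})
  , N-image
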